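{- For every $n\in\mathbb{N}$, \[ t(n)\, n = \sum_{\substack{k\geq 0 \\ T(k)<n}} \left(\sigma^{o}(n- T(k)) - \sigma^{E}(n-T(k))\right). \]
   Context: $\mathbb{N}=\{1,2,3,\ldots\}$, $\mathbb{N}_0=\{0,1,2,\ldots\}$. For $m\in\mathbb{N}_0$, $T(m)=\frac{m(m+1)}{2}$; a number $n\in\mathbb{N}_0$ is triangular if $n=T(m)$ for some $m\in\mathbb{N}_0$, and $t(n)=1$ if $n$ is triangular, $t(n)=0$ otherwise. For $m\in\mathbb{N}$, $\sigma^{o}(m)=\sum_{d\mid m,\ d \text{ odd}} d$ and $\sigma^{E}(m)=\sum_{d\mid m,\ d\text{ even}} d$ (sums over positive divisors). -}

module Defs where

open import Data.Bool.Base using (if_then_else_)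
open import Data.Integer.Base as ℤ using (ℤ; 0ℤ)
open import Data.List.Base using (List; applyUpTo; filter; foldr; upTo)
open import Data.Nat.Base
open import Data.Nat.Divisibility using (_∣?_)
open import Data.Nat.DivMod using (_/_; m*n/n≡m; /-monoˡ-≤)
open import Data.Nat.ListAction using (sum)
open import Data.Nat.Properties
open import Data.Product.Base using (∃; _,_)
open import Relation.Binary.PropositionalEquality using (_≡_; subst; sym)
open import Relation.Nullary.Decidable using (Dec; does; map′; ¬?)

T : ℕ → ℕ
T m = m * (m + 1) / 2

m≤T[m] : ∀ m → m ≤ T m
m≤T[m] zero    = z≤n
m≤T[m] (suc m) = begin
  suc m                   ≡⟨ m*n/n≡m (suc m) 2 ⟨
  suc m * 2 / 2           ≤⟨ /-monoˡ-≤ 2 (*-monoʳ-≤ (suc m) (+-monoˡ-≤ 1 (s≤s (z≤n {m})))) ⟩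
  suc m * (suc m + 1) / 2 ∎
  where open ≤-Reasoning

Triangular : ℕ → Set
Triangular n = ∃ λ m → n ≡ T m

triangular? : ∀ n → Dec (Triangular n)
triangular? n = map′
  (λ (m , _ , n≡T[m]) → m , n≡T[m])
  (λ (m , n≡T[m]) → m , s≤s (subst (m ≤_) (sym n≡T[m]) (m≤T[m] m)) , n≡T[m])
  (anyUpTo? (λ m → n ≟ T m) (suc n))

t : ℕ → ℕ
t n = if does (triangular? n) then 1 else 0

-- The positive divisors of m lie among 1, …, m when m is positive.
-- (For m = 0 the list is empty; that value is a convention.)
divisors : ℕ → List ℕ
divisors m = filter (_∣? m) (applyUpTo suc m)

σᵒ : ℕ → ℕ
σᵒ m = sum (filter (λ d → ¬? (2 ∣? d)) (divisors m))

σᴱ : ℕ → ℕ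
σᴱ m = sum (filter (2 ∣?_) (divisors m))

-- All k with T k < n. Searching k < n suffices, by m≤T[m].
indices : ℕ → List ℕ
indices n = filter (λ k → T k <? n) (upTo n)

sumℤ : List ℤ → ℤ
sumℤ = foldr ℤ._+_ 0ℤ

{-# OPTIONS --safe #-}
module Submission where

-- Logarithmic differentiation of Gauss' identity
--   Σ_j q^{T(j)} = ∏_k (1 - q^{2k}) / (1 - q^{2k-1}),
-- whose right-hand side has logarithmic derivative Σ_m (σᵒ(m) - σᴱ(m)) q^m.
-- To stay with finite products P n, Gauss' identity is replaced by Shanks'
-- finite form
--   Σ_{j ≤ 2n} q^{T(j)} = Σ_{s ≤ n} (P n / P s) q^{s(2n+1)},
-- in which every term with s > 0 is divisible by q^{2n+1} and hence does not
-- affect the coefficient of q^n.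

open import Defs
open import Algebra.Bundles using (AbelianGroup; CommutativeRing)
import Algebra.Construct.Pointwise as Pointwise
import Algebra.Solver.Ring as RingSolver
open import Algebra.Solver.Ring.AlmostCommutativeRing
  using (_-Raw-AlmostCommutative⟶_; fromCommutativeRing)
open import Data.Bool.Base using (true; false; if_then_else_)
open import Data.Bool.Properties using (if-float)
open import Data.Integer.Base as ℤ using (ℤ; 0ℤ; 1ℤ; +_; _-_)
import Data.Integer.Properties as ℤₚ
import Data.Integer.Solver as ℤSolver
open import Data.List.Base using ([]; _∷_; applyUpTo; filter; map; upTo)
open import Data.Maybe.Base as Maybe using (Maybe)
open import Data.Nat.Base as ℕ
  using (ℕ; zero; suc; z≤n; s≤s; NonZero; _*_; _∸_; _≤_; _<_; _≤′_; ≤′-refl; ≤′-step)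
open import Data.Nat.Divisibility
open import Data.Nat.DivMod using (+-distrib-/-∣ʳ; /-monoˡ-≤; m*n/n≡m)
open import Data.Nat.ListAction using (sum)
open import Data.Nat.Properties
import Data.Nat.Solver as ℕSolver
open import Data.Product.Base using (_,_)
open import Function.Base using (_∘_; const; id)
open import Function.Bundles using (mk⇔)
open import Level using (0ℓ)
open import Relation.Binary.Definitions using (tri<; tri≈; tri>)
open import Relation.Binary.PropositionalEquality
  using (_≡_; _≢_; refl; sym; trans; cong; cong₂; subst; ≢-sym; module ≡-Reasoning)
import Relation.Binary.Reasoning.Setoid as SetoidReasoning
open import Relation.Nullary.Decidable
  using (Dec; yes; no; does; dec⇒maybe; does-⇔; ¬?; dec-true; dec-false)
open import Relation.Nullary.Negation using (contradiction)
open import Relation.Unary using (Decidable)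

infix 9 q^_ 1-q^_

-- Formal power series over ℤ

Series : Set
Series = ℕ → ℤ

seriesGroup : AbelianGroup 0ℓ 0ℓ
seriesGroup = Pointwise.abelianGroup ℕ ℤₚ.+-0-abelianGroup

open AbelianGroup seriesGroup using () renaming
  (_≈_ to infix 4 _≈_; _∙_ to infixl 6 _⊕_; _⁻¹ to infix 8 ⊝_;
   isAbelianGroup to ⊕-isAbelianGroup; ∙-cong to ⊕-cong;
   refl to ≈-refl; sym to ≈-sym; trans to ≈-trans)

⊕-congˡ : ∀ f {g g′} → g ≈ g′ → f ⊕ g ≈ f ⊕ g′
⊕-congˡ f g≈g′ n = cong (ℤ._+_ (f n)) (g≈g′ n)

constant : ℤ → Series
constant a zero    = a
constant a (suc _) = 0ℤ

infixl 7 _⊛_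

-- The Cauchy product by recursion on the coefficient index: the head of `f` is split off and its
-- tail `f ∘ suc` takes over. No index is subtracted, and inductions on `n` generalise over `f`.
_⊛_ : Series → Series → Series
(f ⊛ g) zero    = f 0 ℤ.* g 0
(f ⊛ g) (suc n) = f 0 ℤ.* g (suc n) ℤ.+ (f ∘ suc ⊛ g) n

⊛-cong : ∀ {f f′ g g′} → f ≈ f′ → g ≈ g′ → f ⊛ g ≈ f′ ⊛ g′
⊛-cong p q zero    = cong₂ ℤ._*_ (p 0) (q 0)
⊛-cong p q (suc n) =
  cong₂ ℤ._+_ (cong₂ ℤ._*_ (p 0) (q (suc n))) (⊛-cong (p ∘ suc) q n)

⊛-zeroˡ : ∀ f → const 0ℤ ⊛ f ≈ const 0ℤ
⊛-zeroˡ f zero    = refl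
⊛-zeroˡ f (suc n) = trans (ℤₚ.+-identityˡ _) (⊛-zeroˡ f n)

⊛-identityˡ : ∀ f → constant 1ℤ ⊛ f ≈ f
⊛-identityˡ f zero    = ℤₚ.*-identityˡ _
⊛-identityˡ f (suc n) =
  trans (cong₂ ℤ._+_ (ℤₚ.*-identityˡ (f (suc n))) (⊛-zeroˡ f n)) (ℤₚ.+-identityʳ _)

⊛-distribʳ-⊕ : ∀ h f g → (f ⊕ g) ⊛ h ≈ f ⊛ h ⊕ g ⊛ h
⊛-distribʳ-⊕ h f g zero    = ℤₚ.*-distribʳ-+ (h 0) (f 0) (g 0)
⊛-distribʳ-⊕ h f g (suc n) =
  trans (cong (ℤ._+_ ((f 0 ℤ.+ g 0) ℤ.* h (suc n))) (⊛-distribʳ-⊕ h (f ∘ suc) (g ∘ suc) n))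
    (solve 5 (λ a b c x y → (a :+ b) :* c :+ (x :+ y) := a :* c :+ x :+ (b :* c :+ y))
      refl (f 0) (g 0) (h (suc n)) ((f ∘ suc ⊛ h) n) ((g ∘ suc ⊛ h) n))
  where open ℤSolver.+-*-Solver

⊛-scaleˡ : ∀ a f g → (λ n → a ℤ.* f n) ⊛ g ≈ λ n → a ℤ.* (f ⊛ g) n
⊛-scaleˡ a f g zero    = ℤₚ.*-assoc a (f 0) (g 0)
⊛-scaleˡ a f g (suc n) =
  trans (cong (ℤ._+_ (a ℤ.* f 0 ℤ.* g (suc n))) (⊛-scaleˡ a (f ∘ suc) g n))
    (solve 4 (λ a b c x → a :* b :* c :+ a :* x := a :* (b :* c :+ x))
      refl a (f 0) (g (suc n)) ((f ∘ suc ⊛ g) n))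
  where open ℤSolver.+-*-Solver

-- The tail of `f ⊛ g` is, by definition, `f 0` times the tail of `g` plus the tail of `f` times
-- `g`. Distributivity and scaling therefore reduce the claim at `suc n` to the tail of `f` at `n`.
⊛-assoc : ∀ f g h → (f ⊛ g) ⊛ h ≈ f ⊛ (g ⊛ h)
⊛-assoc f g h zero    = ℤₚ.*-assoc (f 0) (g 0) (h 0)
⊛-assoc f g h (suc n) = begin
  f 0 ℤ.* g 0 ℤ.* h (suc n) ℤ.+ (((λ m → f 0 ℤ.* g (suc m)) ⊕ (f ∘ suc ⊛ g)) ⊛ h) n
    ≡⟨ cong (ℤ._+_ (f 0 ℤ.* g 0 ℤ.* h (suc n)))
         (⊛-distribʳ-⊕ h (λ m → f 0 ℤ.* g (suc m)) (f ∘ suc ⊛ g) n) ⟩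
  f 0 ℤ.* g 0 ℤ.* h (suc n) ℤ.+
    (((λ m → f 0 ℤ.* g (suc m)) ⊛ h) n ℤ.+ (f ∘ suc ⊛ g ⊛ h) n)
    ≡⟨ cong (ℤ._+_ (f 0 ℤ.* g 0 ℤ.* h (suc n)))
         (cong₂ ℤ._+_ (⊛-scaleˡ (f 0) (g ∘ suc) h n) (⊛-assoc (f ∘ suc) g h n)) ⟩
  f 0 ℤ.* g 0 ℤ.* h (suc n) ℤ.+ (f 0 ℤ.* (g ∘ suc ⊛ h) n ℤ.+ (f ∘ suc ⊛ (g ⊛ h)) n)
    ≡⟨ solve 5 (λ a b c x y → a :* b :* c :+ (a :* x :+ y) := a :* (b :* c :+ x) :+ y)
         refl (f 0) (g 0) (h (suc n)) ((g ∘ suc ⊛ h) n) ((f ∘ suc ⊛ (g ⊛ h)) n) ⟩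
  f 0 ℤ.* (g ⊛ h) (suc n) ℤ.+ (f ∘ suc ⊛ (g ⊛ h)) n ∎
  where
  open ≡-Reasoning
  open ℤSolver.+-*-Solver

-- The defining recursion treats the factors asymmetrically. This is its mirror image, which
-- commutativity needs.
⊛-sucʳ : ∀ f g n → (f ⊛ g) (suc n) ≡ f (suc n) ℤ.* g 0 ℤ.+ (f ⊛ g ∘ suc) n
⊛-sucʳ f g zero    = ℤₚ.+-comm (f 0 ℤ.* g 1) (f 1 ℤ.* g 0)
⊛-sucʳ f g (suc n) =
  trans (cong (ℤ._+_ (f 0 ℤ.* g (suc (suc n)))) (⊛-sucʳ (f ∘ suc) g n))
    (solve 3 (λ a b c → a :+ (b :+ c) := b :+ (a :+ c))
      refl (f 0 ℤ.* g (suc (suc n))) (f (suc (suc n)) ℤ.* g 0) ((f ∘ suc ⊛ g ∘ suc) n))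
  where open ℤSolver.+-*-Solver

⊛-comm : ∀ f g → f ⊛ g ≈ g ⊛ f
⊛-comm f g zero    = ℤₚ.*-comm (f 0) (g 0)
⊛-comm f g (suc n) =
  trans (cong₂ ℤ._+_ (ℤₚ.*-comm (f 0) (g (suc n))) (⊛-comm (f ∘ suc) g n))
    (sym (⊛-sucʳ g f n))

seriesRing : CommutativeRing 0ℓ 0ℓ
seriesRing = record
  { _≈_ = _≈_
  ; _+_ = _⊕_
  ; _*_ = _⊛_
  ; -_  = ⊝_
  ; 0#  = const 0ℤ
  ; 1#  = constant 1ℤ
  ; isCommutativeRing = record
    { isRing = record
      { +-isAbelianGroup = ⊕-isAbelianGroup
      ; *-cong           = ⊛-cong
      ; *-assoc          = ⊛-assoc
      ; *-identity       = ⊛-identityˡ , λ f n → trans (⊛-comm f (constant 1ℤ) n) (⊛-identityˡ f n)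
      ; distrib          =
          (λ h f g n → trans (⊛-comm h (f ⊕ g) n) (trans (⊛-distribʳ-⊕ h f g n)
            (cong₂ ℤ._+_ (⊛-comm f h n) (⊛-comm g h n))))
        , ⊛-distribʳ-⊕
      }
    ; *-comm = ⊛-comm
    }
  }

-- Equality of series is undecidable, so the ring solver takes its coefficients from ℤ. Under this
-- embedding `con 1ℤ` is read as `one`.
constant-homomorphism :
  CommutativeRing.rawRing ℤₚ.+-*-commutativeRing
    -Raw-AlmostCommutative⟶ fromCommutativeRing seriesRing
constant-homomorphism = record
  { ⟦_⟧    = constant
  ; +-homo = λ { a b zero → refl ; a b (suc n) → refl }
  ; *-homo = λ { a b zero → refl
               ; a b (suc n) → sym (cong₂ ℤ._+_ (ℤₚ.*-zeroʳ a) (⊛-zeroˡ (constant b) n)) }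
  ; -‿homo = λ { a zero → refl ; a (suc n) → refl }
  ; 0-homo = λ { zero → refl ; (suc n) → refl }
  ; 1-homo = λ _ → refl
  }

constant-≟ : ∀ a b → Maybe (constant a ≈ constant b)
constant-≟ a b = Maybe.map (λ a≡b n → cong (λ c → constant c n) a≡b) (dec⇒maybe (a ℤₚ.≟ b))

module SeriesSolver = RingSolver
  (CommutativeRing.rawRing ℤₚ.+-*-commutativeRing) (fromCommutativeRing seriesRing)
  constant-homomorphism constant-≟

open CommutativeRing seriesRing using () renaming
  (setoid to seriesSetoid; distribˡ to ⊛-distribˡ-⊕; *-identityʳ to ⊛-identityʳ)


-- Monomials, the derivation q d/dq and geometric series

one : Series
one = constant 1ℤ

constant-⊛ : ∀ a f n → (constant a ⊛ f) n ≡ a ℤ.* f n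
constant-⊛ a f zero    = refl
constant-⊛ a f (suc n) =
  trans (cong (ℤ._+_ (a ℤ.* f (suc n))) (⊛-zeroˡ f n)) (ℤₚ.+-identityʳ (a ℤ.* f (suc n)))

q^_ : ℕ → Series
(q^ zero)          = one
(q^ (suc k)) zero    = 0ℤ
(q^ (suc k)) (suc n) = (q^ k) n

q^k-⊛-< : ∀ {k n} f → n < k → (q^ k ⊛ f) n ≡ 0ℤ
q^k-⊛-< {suc k} {zero}  f _         = refl
q^k-⊛-< {suc k} {suc n} f (s≤s n<k) = trans (ℤₚ.+-identityˡ _) (q^k-⊛-< f n<k)

q^k-⊛-≥ : ∀ {k n} f → k ≤ n → (q^ k ⊛ f) n ≡ f (n ∸ k)
q^k-⊛-≥ {zero}  {n}     f _         = ⊛-identityˡ f n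
q^k-⊛-≥ {suc k} {suc n} f (s≤s k≤n) = trans (ℤₚ.+-identityˡ _) (q^k-⊛-≥ f k≤n)

q^-+ : ∀ j k → q^ (j ℕ.+ k) ≈ q^ j ⊛ q^ k
q^-+ zero    k n       = sym (⊛-identityˡ (q^ k) n)
q^-+ (suc j) k zero    = refl
q^-+ (suc j) k (suc n) = trans (q^-+ j k n) (sym (ℤₚ.+-identityˡ _))

q^-suc : ∀ k → q^ (suc k) ≈ q^ 1 ⊛ q^ k
q^-suc = q^-+ 1

q^k-diagonal : ∀ k → (q^ k) k ≡ 1ℤ
q^k-diagonal zero    = refl
q^k-diagonal (suc k) = q^k-diagonal k

q^k-offDiagonal : ∀ {k n} → k ≢ n → (q^ k) n ≡ 0ℤ
q^k-offDiagonal {zero}  {zero}  k≢n = contradiction refl k≢n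
q^k-offDiagonal {zero}  {suc n} k≢n = refl
q^k-offDiagonal {suc k} {zero}  k≢n = refl
q^k-offDiagonal {suc k} {suc n} k≢n = q^k-offDiagonal (k≢n ∘ cong suc)

-- The derivation q d/dq.
θ : Series → Series
θ f n = + n ℤ.* f n

θ-cong : ∀ {f g} → f ≈ g → θ f ≈ θ g
θ-cong f≈g n = cong (ℤ._*_ (+ n)) (f≈g n)

θ-⊕ : ∀ f g → θ (f ⊕ g) ≈ θ f ⊕ θ g
θ-⊕ f g n = ℤₚ.*-distribˡ-+ (+ n) (f n) (g n)

-- Induction on the index. Raising it by one adds an extra copy of `(f ∘ suc ⊛ g) n`, and `θ-tail`
-- absorbs that copy: the tail of `θ f` is `θ` of the tail of `f` plus the tail itself.
θ-⊛ : ∀ f g → θ (f ⊛ g) ≈ θ f ⊛ g ⊕ f ⊛ θ g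
θ-⊛ f g zero    = sym (cong (ℤ._+_ 0ℤ) (ℤₚ.*-zeroʳ (f 0)))
θ-⊛ f g (suc n) = begin
  + suc n ℤ.* (f 0 ℤ.* g (suc n) ℤ.+ (f ∘ suc ⊛ g) n)
    ≡⟨⟩
  (1ℤ ℤ.+ + n) ℤ.* (f 0 ℤ.* g (suc n) ℤ.+ (f ∘ suc ⊛ g) n)
    ≡⟨ solve 4 (λ k a b x → (con 1ℤ :+ k) :* (a :* b :+ x)
                          := (con 1ℤ :+ k) :* (a :* b) :+ (k :* x :+ x))
         refl (+ n) (f 0) (g (suc n)) ((f ∘ suc ⊛ g) n) ⟩
  (1ℤ ℤ.+ + n) ℤ.* (f 0 ℤ.* g (suc n)) ℤ.+ (θ (f ∘ suc ⊛ g) n ℤ.+ (f ∘ suc ⊛ g) n)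
    ≡⟨ cong (λ x → (1ℤ ℤ.+ + n) ℤ.* (f 0 ℤ.* g (suc n)) ℤ.+ (x ℤ.+ (f ∘ suc ⊛ g) n))
         (θ-⊛ (f ∘ suc) g n) ⟩
  (1ℤ ℤ.+ + n) ℤ.* (f 0 ℤ.* g (suc n)) ℤ.+
    ((θ (f ∘ suc) ⊛ g) n ℤ.+ (f ∘ suc ⊛ θ g) n ℤ.+ (f ∘ suc ⊛ g) n)
    ≡⟨ solve 6 (λ k a b x y z → k :* (a :* b) :+ (x :+ y :+ z)
                              := (x :+ z) :+ (a :* (k :* b) :+ y))
         refl (1ℤ ℤ.+ + n) (f 0) (g (suc n))
         ((θ (f ∘ suc) ⊛ g) n) ((f ∘ suc ⊛ θ g) n) ((f ∘ suc ⊛ g) n) ⟩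
  ((θ (f ∘ suc) ⊛ g) n ℤ.+ (f ∘ suc ⊛ g) n) ℤ.+
    (f 0 ℤ.* ((1ℤ ℤ.+ + n) ℤ.* g (suc n)) ℤ.+ (f ∘ suc ⊛ θ g) n)
    ≡⟨ cong (λ x → x ℤ.+ (f ⊛ θ g) (suc n)) (⊛-distribʳ-⊕ g (θ (f ∘ suc)) (f ∘ suc) n) ⟨
  ((θ (f ∘ suc) ⊕ f ∘ suc) ⊛ g) n ℤ.+ (f ⊛ θ g) (suc n)
    ≡⟨ cong (λ x → x ℤ.+ (f ⊛ θ g) (suc n)) (⊛-cong θ-tail (λ _ → refl) n) ⟩
  (θ f ∘ suc ⊛ g) n ℤ.+ (f ⊛ θ g) (suc n)
    -- The restored 0ℤ is the head term of `θ f ⊛ g`, since `θ f` has constant coefficient zero.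
    ≡⟨ cong (λ x → x ℤ.+ (f ⊛ θ g) (suc n)) (sym (ℤₚ.+-identityˡ ((θ f ∘ suc ⊛ g) n))) ⟩
  (θ f ⊛ g ⊕ f ⊛ θ g) (suc n) ∎
  where
  open ≡-Reasoning
  open ℤSolver.+-*-Solver
  θ-tail : θ (f ∘ suc) ⊕ f ∘ suc ≈ θ f ∘ suc
  θ-tail m = solve 2 (λ k x → k :* x :+ x := (con 1ℤ :+ k) :* x) refl (+ m) (f (suc m))

θ-constant : ∀ a → θ (constant a) ≈ const 0ℤ
θ-constant a zero    = refl
θ-constant a (suc n) = ℤₚ.*-zeroʳ (+ suc n)

θ-q^ : ∀ k → θ (q^ k) ≈ constant (+ k) ⊛ q^ k
θ-q^ k n with k ≟ n
... | yes refl = sym (constant-⊛ (+ k) (q^ k) k)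
... | no k≢n   = begin
  + n ℤ.* (q^ k) n            ≡⟨ cong (ℤ._*_ (+ n)) (q^k-offDiagonal k≢n) ⟩
  + n ℤ.* 0ℤ                  ≡⟨ ℤₚ.*-zeroʳ (+ n) ⟩
  0ℤ                          ≡⟨ ℤₚ.*-zeroʳ (+ k) ⟨
  + k ℤ.* 0ℤ                  ≡⟨ cong (ℤ._*_ (+ k)) (q^k-offDiagonal k≢n) ⟨
  + k ℤ.* (q^ k) n            ≡⟨ constant-⊛ (+ k) (q^ k) n ⟨
  (constant (+ k) ⊛ q^ k) n   ∎
  where open ≡-Reasoning

1-q^_ : ℕ → Series
1-q^ d = one ⊕ ⊝ q^ d

-- 1 / (1 - q^d) = Σ q^(d j), for positive d.
geometric : ℕ → Series
geometric d n = if does (d ∣? n) then 1ℤ else 0ℤ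

geometric-period : ∀ {d n} → d ≤ n → geometric d (n ∸ d) ≡ geometric d n
geometric-period {d} {n} d≤n = cong (if_then 1ℤ else 0ℤ) (does-⇔
  (mk⇔ (λ d∣n∸d → ∣m∸n∣n⇒∣m d d≤n d∣n∸d ∣-refl)
       (λ d∣n → ∣m+n∣m⇒∣n (subst (d ∣_) (sym (m+[n∸m]≡n d≤n)) d∣n) ∣-refl))
  (d ∣? (n ∸ d)) (d ∣? n))

geometric-∤ : ∀ {d n} → d ∤ n → geometric d n ≡ 0ℤ
geometric-∤ {d} {n} d∤n = cong (if_then 1ℤ else 0ℤ) (dec-false (d ∣? n) d∤n)

-- Multiplication by q^d shifts the coefficients by `d`, so the difference cancels by periodicity
-- from index `d` on. Below `d`, only index 0 is a multiple of `d`.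
geometric-inverse : ∀ d .{{_ : NonZero d}} → 1-q^ d ⊛ geometric d ≈ one
geometric-inverse d n = trans expand (coefficient n)
  where
  expand : (1-q^ d ⊛ geometric d) n ≡ geometric d n - (q^ d ⊛ geometric d) n
  expand = solve 2 (λ x g → (con 1ℤ :- x) :* g := g :- x :* g) (λ _ → refl)
    (q^ d) (geometric d) n
    where open SeriesSolver
  coefficient : ∀ m → geometric d m - (q^ d ⊛ geometric d) m ≡ one m
  coefficient m with d ≤? m
  coefficient zero    | yes d≤0 = contradiction (n≤0⇒n≡0 d≤0) (ℕ.≢-nonZero⁻¹ d)
  coefficient (suc m) | yes d≤m = ℤₚ.i≡j⇒i-j≡0 (sym (trans (q^k-⊛-≥ (geometric d) d≤m) (geometric-period d≤m)))
  coefficient zero    | no d≰m =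
    cong₂ _-_ (cong (if_then 1ℤ else 0ℤ) (dec-true (d ∣? 0) (d ∣0))) (q^k-⊛-< (geometric d) (≰⇒> d≰m))
  coefficient (suc m) | no d≰m =
    cong₂ _-_ (geometric-∤ (>⇒∤ (≰⇒> d≰m))) (q^k-⊛-< (geometric d) (≰⇒> d≰m))

-- The logarithmic derivative of 1 / (1 - q^d).
lambert : ℕ → Series
lambert d = constant (+ d) ⊛ (geometric d ⊕ ⊝ one)

-- The derivative is -d q^d. To exhibit the factor 1 - q^d, q^d is written as 1 - (1 - q^d), and
-- then the first 1 as (1 - q^d) times `geometric d`.
θ-1-q^ : ∀ d .{{_ : NonZero d}} → θ (1-q^ d) ≈ ⊝ lambert d ⊛ 1-q^ d
θ-1-q^ d = begin
  θ (1-q^ d)                                   ≈⟨ (λ n → trans (ℤₚ.*-distribˡ-+ (+ n) (one n) _)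
                                                    (cong₂ ℤ._+_ (θ-constant 1ℤ n) (sym (ℤₚ.neg-distribʳ-* (+ n) _)))) ⟩
  const 0ℤ ⊕ ⊝ θ (q^ d)                        ≈⟨ (λ n → cong (λ x → 0ℤ ℤ.+ ℤ.- x) (θ-q^ d n)) ⟩
  const 0ℤ ⊕ ⊝ (c ⊛ q^ d)                      ≈⟨ (λ n → ℤₚ.+-identityˡ _) ⟩
  ⊝ (c ⊛ q^ d)                                 ≈⟨ solve 2 (λ c x → :- (c :* x) := :- c :* (con 1ℤ :- (con 1ℤ :- x)))
                                                    (λ _ → refl) c (q^ d) ⟩
  ⊝ c ⊛ (one ⊕ ⊝ 1-q^ d)                       ≈⟨ ⊛-cong (λ _ → refl)
                                                    (λ n → cong (λ x → x - (1-q^ d) n) (sym (geometric-inverse d n))) ⟩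
  ⊝ c ⊛ (1-q^ d ⊛ geometric d ⊕ ⊝ 1-q^ d)      ≈⟨ solve 3 (λ c x g → :- c :* (x :* g :- x) := :- (c :* (g :- con 1ℤ)) :* x)
                                                    (λ _ → refl) c (1-q^ d) (geometric d) ⟩
  ⊝ lambert d ⊛ 1-q^ d ∎
  where
  open SetoidReasoning seriesSetoid
  open SeriesSolver
  c = constant (+ d)

-- Differentiating `geometric-inverse` by the product rule gives a linear equation for
-- `θ (geometric d)`, which is solved by multiplying with `geometric d`.
θ-geometric : ∀ d .{{_ : NonZero d}} → θ (geometric d) ≈ lambert d ⊛ geometric d
θ-geometric d = begin
  θ g                               ≈⟨ ⊛-identityˡ (θ g) ⟨
  one ⊛ θ g                         ≈⟨ ⊛-cong (geometric-inverse d) (λ _ → refl) ⟨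
  -- The first bracket on the right is the derivative of (1 - q^d) g = 1, hence zero by `vanish`.
  -- The compensating last term carries the result.
  1-q^ d ⊛ g ⊛ θ g                  ≈⟨ solve 4 (λ x g u l → x :* g :* u
                                         := (:- l :* x :* g :+ x :* u) :* g :+ l :* (x :* g) :* g)
                                         (λ _ → refl) (1-q^ d) g (θ g) (lambert d) ⟩
  (⊝ lambert d ⊛ 1-q^ d ⊛ g ⊕ 1-q^ d ⊛ θ g) ⊛ g ⊕ lambert d ⊛ (1-q^ d ⊛ g) ⊛ g
    ≈⟨ ⊕-cong (⊛-cong vanish (λ _ → refl)) (⊛-cong (⊛-cong (λ _ → refl) (geometric-inverse d)) (λ _ → refl)) ⟩
  const 0ℤ ⊛ g ⊕ lambert d ⊛ one ⊛ g ≈⟨ ⊕-cong (⊛-zeroˡ g) (⊛-cong (⊛-comm (lambert d) one) (λ _ → refl)) ⟩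
  const 0ℤ ⊕ one ⊛ lambert d ⊛ g     ≈⟨ (λ n → ℤₚ.+-identityˡ _) ⟩
  one ⊛ lambert d ⊛ g               ≈⟨ ⊛-cong (⊛-identityˡ (lambert d)) (λ _ → refl) ⟩
  lambert d ⊛ g                     ∎
  where
  open SetoidReasoning seriesSetoid
  open SeriesSolver
  g = geometric d
  vanish : ⊝ lambert d ⊛ 1-q^ d ⊛ g ⊕ 1-q^ d ⊛ θ g ≈ const 0ℤ
  vanish = begin
    ⊝ lambert d ⊛ 1-q^ d ⊛ g ⊕ 1-q^ d ⊛ θ g ≈⟨ ⊕-cong (⊛-cong (θ-1-q^ d) (λ _ → refl)) (λ _ → refl) ⟨
    θ (1-q^ d) ⊛ g ⊕ 1-q^ d ⊛ θ g           ≈⟨ θ-⊛ (1-q^ d) g ⟨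
    θ (1-q^ d ⊛ g)                          ≈⟨ θ-cong (geometric-inverse d) ⟩
    θ one                                   ≈⟨ θ-constant 1ℤ ⟩
    const 0ℤ                                ∎

-- Shanks' identity

∑ : ℕ → (ℕ → ℤ) → ℤ
∑ zero    f = 0ℤ
∑ (suc n) f = ∑ n f ℤ.+ f n

-- The empty sum is `constant 0ℤ`, not the ring's `const 0ℤ`, because this is how the solver reads
-- `con 0ℤ`.
∑ˢ : ℕ → (ℕ → Series) → Series
∑ˢ zero    f = constant 0ℤ
∑ˢ (suc n) f = ∑ˢ n f ⊕ f n

∑ˢ-coefficient : ∀ n f m → ∑ˢ n f m ≡ ∑ n (λ i → f i m)
∑ˢ-coefficient zero    f zero    = refl
∑ˢ-coefficient zero    f (suc m) = refl
∑ˢ-coefficient (suc n) f m       = cong (λ x → x ℤ.+ f n m) (∑ˢ-coefficient n f m)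

-- P n = ∏_{k=1}^n (1 - q^{2k}) / (1 - q^{2k-1}).
P : ℕ → Series
P zero    = one
P (suc n) = P n ⊛ (1-q^ (2 * suc n) ⊛ geometric (suc (2 * n)))

-- The reciprocal of `P n` as an explicit product. It expresses the quotient P n / P s in Shanks'
-- identity as `P n ⊛ Q s`, without division.
Q : ℕ → Series
Q zero    = one
Q (suc n) = Q n ⊛ (1-q^ suc (2 * n) ⊛ geometric (2 * suc n))

P-Q-inverse : ∀ n → P n ⊛ Q n ≈ one
P-Q-inverse zero    = ⊛-identityˡ one
P-Q-inverse (suc n) = begin
  P (suc n) ⊛ Q (suc n)
    ≈⟨ solve 6 (λ p q x x⁻¹ y y⁻¹ → p :* (x :* y⁻¹) :* (q :* (y :* x⁻¹))
                                 := p :* q :* ((x :* x⁻¹) :* (y :* y⁻¹)))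
         (λ _ → refl) (P n) (Q n) (1-q^ (2 * suc n)) (geometric (2 * suc n))
         (1-q^ suc (2 * n)) (geometric (suc (2 * n))) ⟩
  P n ⊛ Q n ⊛ (1-q^ (2 * suc n) ⊛ geometric (2 * suc n) ⊛ (1-q^ suc (2 * n) ⊛ geometric (suc (2 * n))))
    ≈⟨ ⊛-cong (P-Q-inverse n) (⊛-cong (geometric-inverse (2 * suc n)) (geometric-inverse (suc (2 * n)))) ⟩
  one ⊛ (one ⊛ one) ≈⟨ solve 0 (con 1ℤ :* (con 1ℤ :* con 1ℤ) := con 1ℤ) (λ _ → refl) ⟩
  one ∎
  where
  open SetoidReasoning seriesSetoid
  open SeriesSolver

-- The logarithmic derivative of `P n`: each denominator 1 - q^(2k-1) contributes with a plus sign,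
-- each numerator 1 - q^(2k) with a minus sign.
L : ℕ → Series
L zero    = constant 0ℤ
L (suc n) = L n ⊕ (lambert (suc (2 * n)) ⊕ ⊝ lambert (2 * suc n))

θ-P : ∀ n → θ (P n) ≈ P n ⊛ L n
θ-P zero zero    = refl
θ-P zero (suc m) = trans (θ-constant 1ℤ (suc m)) (sym (⊛-identityˡ (constant 0ℤ) (suc m)))
θ-P (suc n) = begin
  θ (P n ⊛ (x ⊛ g))                          ≈⟨ θ-⊛ (P n) (x ⊛ g) ⟩
  θ (P n) ⊛ (x ⊛ g) ⊕ P n ⊛ θ (x ⊛ g)        ≈⟨ ⊕-cong (⊛-cong (θ-P n) ≈-refl) (⊛-cong ≈-refl (θ-⊛ x g)) ⟩
  P n ⊛ L n ⊛ (x ⊛ g) ⊕ P n ⊛ (θ x ⊛ g ⊕ x ⊛ θ g)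
    ≈⟨ ⊕-congˡ (P n ⊛ L n ⊛ (x ⊛ g)) (⊛-cong ≈-refl (⊕-cong
         (⊛-cong (θ-1-q^ (2 * suc n)) ≈-refl)
         (⊛-cong ≈-refl (θ-geometric (suc (2 * n)))))) ⟩
  P n ⊛ L n ⊛ (x ⊛ g) ⊕ P n ⊛ (⊝ ℓ₂ ⊛ x ⊛ g ⊕ x ⊛ (ℓ₁ ⊛ g))
    ≈⟨ solve 6 (λ p l x g l₁ l₂ → p :* l :* (x :* g) :+ p :* (:- l₂ :* x :* g :+ x :* (l₁ :* g))
                               := p :* (x :* g) :* (l :+ (l₁ :- l₂)))
         (λ _ → refl) (P n) (L n) x g ℓ₁ ℓ₂ ⟩
  P n ⊛ (x ⊛ g) ⊛ (L n ⊕ (ℓ₁ ⊕ ⊝ ℓ₂)) ∎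
  where
  open SetoidReasoning seriesSetoid
  open SeriesSolver
  x = 1-q^ (2 * suc n)
  g = geometric (suc (2 * n))
  ℓ₁ = lambert (suc (2 * n))
  ℓ₂ = lambert (2 * suc n)

-- P n ⊛ V n (suc n) is the right-hand side of Shanks' identity.
V : ℕ → ℕ → Series
V n r = ∑ˢ r (λ s → Q s ⊛ q^ (s * suc (2 * n)))

-- The recurrence of `Q` with its denominator cleared. It turns the remainder left over in
-- `V-telescope` at `r` into the one at `suc r`.
Q-suc : ∀ r → Q (suc r) ⊛ 1-q^ (2 * suc r) ≈ Q r ⊛ 1-q^ suc (2 * r)
Q-suc r = begin
  Q r ⊛ (y ⊛ g) ⊛ x     ≈⟨ solve 4 (λ q y g x → q :* (y :* g) :* x := q :* y :* (x :* g)) (λ _ → refl) (Q r) y g x ⟩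
  Q r ⊛ y ⊛ (x ⊛ g)     ≈⟨ ⊛-cong ≈-refl (geometric-inverse (2 * suc r)) ⟩
  Q r ⊛ y ⊛ one         ≈⟨ ⊛-comm (Q r ⊛ y) one ⟩
  one ⊛ (Q r ⊛ y)       ≈⟨ ⊛-identityˡ (Q r ⊛ y) ⟩
  Q r ⊛ y ∎
  where
  open SetoidReasoning seriesSetoid
  open SeriesSolver
  x = 1-q^ (2 * suc r)
  y = 1-q^ suc (2 * r)
  g = geometric (2 * suc r)

q^-2+2r : ∀ r → q^ (2 * suc r) ≈ q^ 1 ⊛ q^ suc (2 * r)
q^-2+2r r n = trans (cong (λ k → (q^ k) n) (*-suc 2 r)) (q^-suc (suc (2 * r)) n)

exponent-split : ∀ r n → r * suc (2 * suc n) ≡ r * suc (2 * n) ℕ.+ 2 * r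
exponent-split = solve 2 (λ r n →
  r :* (con 1 :+ con 2 :* (con 1 :+ n)) := r :* (con 1 :+ con 2 :* n) :+ con 2 :* r) refl
  where open ℕSolver.+-*-Solver

-- Passing from `n` to `suc n` changes every term of the sum, but the changes telescope in `r` to
-- the single last product. For `r` = 0 that product vanishes because of its factor 1 - q^0.
V-telescope : ∀ n r → P (suc n) ⊛ V (suc n) r
  ≈ P n ⊛ V n r ⊕ P n ⊛ geometric (suc (2 * n)) ⊛ (Q r ⊛ q^ (r * suc (2 * n)) ⊛ 1-q^ (2 * r))
V-telescope n zero = solve 3 (λ a p g →
    a :* con 0ℤ := p :* con 0ℤ :+ p :* g :* (con 1ℤ :* con 1ℤ :* (con 1ℤ :- con 1ℤ))) (λ _ → refl)
  (P (suc n)) (P n) (geometric (suc (2 * n)))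
  where open SeriesSolver
V-telescope n (suc r) = begin
  P (suc n) ⊛ (V (suc n) r ⊕ Q r ⊛ q^ (r * suc (2 * suc n)))
    ≈⟨ ⊛-distribˡ-⊕ (P (suc n)) (V (suc n) r) (Q r ⊛ q^ (r * suc (2 * suc n))) ⟩
  P (suc n) ⊛ V (suc n) r ⊕ P (suc n) ⊛ (Q r ⊛ q^ (r * suc (2 * suc n)))
    ≈⟨ ⊕-cong (V-telescope n r)
        (⊛-cong (⊛-cong ≈-refl (⊛-cong 1-q^-xy ≈-refl)) (⊛-cong ≈-refl exponent)) ⟩
  p ⊛ v ⊕ p ⊛ g ⊛ (k ⊛ w ⊛ (one ⊕ ⊝ z)) ⊕ p ⊛ ((one ⊕ ⊝ (x ⊛ y)) ⊛ g) ⊛ (k ⊛ (w ⊛ z))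
    -- The core identity is (1 - z) + (1 - xy) z = 1 - xyz = (1 - y) + y (1 - xz). The part with 1 -
    -- y cancels `g` and gives the next term of `V n`; the part with 1 - xz becomes the next
    -- remainder.
    ≈⟨ solve 8 (λ p v g k w x y z →
         p :* v :+ p :* g :* (k :* w :* (con 1ℤ :- z))
           :+ p :* ((con 1ℤ :- x :* y) :* g) :* (k :* (w :* z))
         := p :* (v :+ k :* w :* ((con 1ℤ :- y) :* g)) :+ p :* g :* (y :* w) :* (k :* (con 1ℤ :- x :* z)))
       (λ _ → refl) p v g k w x y z ⟩
  p ⊛ (v ⊕ k ⊛ w ⊛ (1-q^ suc (2 * n) ⊛ g)) ⊕ p ⊛ g ⊛ (y ⊛ w) ⊛ (k ⊛ (one ⊕ ⊝ (x ⊛ z)))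
    ≈⟨ ⊕-cong (⊛-cong ≈-refl (⊕-congˡ v
          (≈-trans (⊛-cong ≈-refl (geometric-inverse (suc (2 * n)))) (⊛-identityʳ (k ⊛ w)))))
         (⊛-cong (⊛-cong ≈-refl (≈-sym (q^-+ (suc (2 * n)) (r * suc (2 * n)))))
           (≈-trans (⊛-cong ≈-refl 1-q^-xz) (≈-sym (Q-suc r)))) ⟩
  p ⊛ (v ⊕ k ⊛ w) ⊕ p ⊛ g ⊛ q^ (suc r * suc (2 * n)) ⊛ (Q (suc r) ⊛ 1-q^ (2 * suc r))
    ≈⟨ ⊕-congˡ (p ⊛ V n (suc r)) (solve 5
         (λ p g w k x → p :* g :* w :* (k :* x) := p :* g :* (k :* w :* x)) (λ _ → refl)
         p g (q^ (suc r * suc (2 * n))) (Q (suc r)) (1-q^ (2 * suc r))) ⟩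
  p ⊛ V n (suc r) ⊕ p ⊛ g ⊛ (Q (suc r) ⊛ q^ (suc r * suc (2 * n)) ⊛ 1-q^ (2 * suc r)) ∎
  where
  open SetoidReasoning seriesSetoid
  open SeriesSolver
  p = P n
  v = V n r
  g = geometric (suc (2 * n))
  k = Q r
  w = q^ (r * suc (2 * n))
  x = q^ 1
  y = q^ suc (2 * n)
  z = q^ (2 * r)
  1-q^-xy : 1-q^ (2 * suc n) ≈ one ⊕ ⊝ (x ⊛ y)
  1-q^-xy m = cong (λ a → one m - a) (q^-2+2r n m)
  1-q^-xz : one ⊕ ⊝ (x ⊛ z) ≈ 1-q^ suc (2 * r)
  1-q^-xz m = cong (λ a → one m - a) (sym (q^-suc (2 * r) m))
  exponent : q^ (r * suc (2 * suc n)) ≈ w ⊛ z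
  exponent m = trans (cong (λ i → (q^ i) m) (exponent-split r n)) (q^-+ (r * suc (2 * n)) (2 * r) m)

ψ : ℕ → Series
ψ N = ∑ˢ N (λ j → q^ T j)

T-even : ∀ n → T (2 * n) ≡ n * suc (2 * n)
T-even n = trans
  (cong (ℕ._/ 2) (solve 1 (λ n →
    con 2 :* n :* (con 2 :* n :+ con 1) := n :* (con 1 :+ con 2 :* n) :* con 2) refl n))
  (m*n/n≡m (n * suc (2 * n)) 2)
  where open ℕSolver.+-*-Solver

T-odd : ∀ n → T (suc (2 * n)) ≡ suc n * suc (2 * n)
T-odd n = trans
  (cong (ℕ._/ 2) (solve 1 (λ n → let 1+2n = con 1 :+ con 2 :* n in
    1+2n :* (1+2n :+ con 1) := (con 1 :+ n) :* 1+2n :* con 2) refl n))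
  (m*n/n≡m (suc n * suc (2 * n)) 2)
  where open ℕSolver.+-*-Solver

-- Each step of the induction must add the two triangular exponents T(2n+1) and T(2n+2). The first
-- is the telescoping remainder, collapsed by `last`; the second is the new term s = n + 1, where
-- `P` and `Q` cancel.
shanks : ∀ n → P n ⊛ V n (suc n) ≈ ψ (suc (2 * n))
shanks zero    = solve 0 (con 1ℤ :* (con 0ℤ :+ con 1ℤ :* con 1ℤ) := con 0ℤ :+ con 1ℤ) (λ _ → refl)
  where open SeriesSolver
shanks (suc n) = begin
  P (suc n) ⊛ (V (suc n) (suc n) ⊕ Q (suc n) ⊛ q^ e₂)
    ≈⟨ solve 4 (λ p v k w → p :* (v :+ k :* w) := p :* v :+ p :* k :* w) (λ _ → refl)
         (P (suc n)) (V (suc n) (suc n)) (Q (suc n)) (q^ e₂) ⟩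
  P (suc n) ⊛ V (suc n) (suc n) ⊕ P (suc n) ⊛ Q (suc n) ⊛ q^ e₂
    ≈⟨ ⊕-cong (V-telescope n (suc n)) (≈-trans (⊛-cong (P-Q-inverse (suc n)) ≈-refl) (⊛-identityˡ (q^ e₂))) ⟩
  P n ⊛ V n (suc n) ⊕ P n ⊛ g ⊛ (Q (suc n) ⊛ q^ e₁ ⊛ 1-q^ (2 * suc n)) ⊕ q^ e₂
    ≈⟨ ⊕-cong (⊕-cong (shanks n) last) ≈-refl ⟩
  ψ (suc (2 * n)) ⊕ q^ e₁ ⊕ q^ e₂
    ≈⟨ ⊕-cong (⊕-congˡ (ψ (suc (2 * n))) (λ m → cong (λ i → (q^ i) m) (sym (T-odd n))))
         (λ m → cong (λ i → (q^ i) m) (sym (trans (cong T (sym (*-suc 2 n))) (T-even (suc n))))) ⟩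
  ψ (3 ℕ.+ 2 * n)
    ≈⟨ (λ m → cong (λ i → ψ (suc i) m) (*-suc 2 n)) ⟨
  ψ (suc (2 * suc n)) ∎
  where
  open SetoidReasoning seriesSetoid
  open SeriesSolver
  g = geometric (suc (2 * n))
  e₁ = suc n * suc (2 * n)
  e₂ = suc n * suc (2 * suc n)
  -- `Q-suc` trades the factor 1 - q^(2n+2) for 1 - q^(2n+1), which cancels against `g`; `Q n` then
  -- cancels against `P n`.
  last : P n ⊛ g ⊛ (Q (suc n) ⊛ q^ e₁ ⊛ 1-q^ (2 * suc n)) ≈ q^ e₁
  last = begin
    P n ⊛ g ⊛ (Q (suc n) ⊛ q^ e₁ ⊛ 1-q^ (2 * suc n))
      ≈⟨ solve 5 (λ p g k w x → p :* g :* (k :* w :* x) := p :* g :* w :* (k :* x)) (λ _ → refl)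
           (P n) g (Q (suc n)) (q^ e₁) (1-q^ (2 * suc n)) ⟩
    P n ⊛ g ⊛ q^ e₁ ⊛ (Q (suc n) ⊛ 1-q^ (2 * suc n))
      ≈⟨ ⊛-cong ≈-refl (Q-suc n) ⟩
    P n ⊛ g ⊛ q^ e₁ ⊛ (Q n ⊛ 1-q^ suc (2 * n))
      ≈⟨ solve 5 (λ p g w k x → p :* g :* w :* (k :* x) := p :* k :* (x :* g) :* w) (λ _ → refl)
           (P n) g (q^ e₁) (Q n) (1-q^ suc (2 * n)) ⟩
    P n ⊛ Q n ⊛ (1-q^ suc (2 * n) ⊛ g) ⊛ q^ e₁
      ≈⟨ ⊛-cong (⊛-cong (P-Q-inverse n) (geometric-inverse (suc (2 * n)))) ≈-refl ⟩
    one ⊛ one ⊛ q^ e₁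
      ≈⟨ solve 1 (λ w → con 1ℤ :* con 1ℤ :* w := w) (λ _ → refl) (q^ e₁) ⟩
    q^ e₁ ∎

-- The logarithmic derivative of the theta series up to q^(2n)

H : ℕ → ℕ → Series
H n r = ∑ˢ r (λ s → Q (suc s) ⊛ q^ (s * suc (2 * n)))

-- Every term with s > 0 contains q^(2n+1); `H` collects these terms with one such factor removed.
V-head : ∀ n r → V n (suc r) ≈ one ⊕ q^ suc (2 * n) ⊛ H n r
V-head n zero    = solve 1 (λ y → con 0ℤ :+ con 1ℤ :* con 1ℤ := con 1ℤ :+ y :* con 0ℤ) (λ _ → refl) (q^ suc (2 * n))
  where open SeriesSolver
V-head n (suc r) = begin
  V n (suc r) ⊕ Q (suc r) ⊛ q^ (suc r * suc (2 * n))
    ≈⟨ ⊕-cong (V-head n r) (⊛-cong ≈-refl (q^-+ (suc (2 * n)) (r * suc (2 * n)))) ⟩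
  one ⊕ y ⊛ H n r ⊕ Q (suc r) ⊛ (y ⊛ q^ (r * suc (2 * n)))
    ≈⟨ solve 4 (λ y h k w → con 1ℤ :+ y :* h :+ k :* (y :* w) := con 1ℤ :+ y :* (h :+ k :* w)) (λ _ → refl)
         y (H n r) (Q (suc r)) (q^ (r * suc (2 * n))) ⟩
  one ⊕ y ⊛ H n (suc r) ∎
  where
  open SetoidReasoning seriesSetoid
  open SeriesSolver
  y = q^ suc (2 * n)

-- By `shanks` and `V-head`, `ψ` differs from `P n` by a multiple of q^(2n+1). Neither `θ` nor
-- multiplication by `L n` brings that difference down to an index `m` ≤ 2n, so `θ-P` carries over.
ψ-logarithmicDerivative : ∀ {n m} → m ≤ 2 * n →
  θ (ψ (suc (2 * n))) m ≡ (ψ (suc (2 * n)) ⊛ L n) m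
ψ-logarithmicDerivative {n} {m} m≤2n = begin
  θ (ψ (suc (2 * n))) m                  ≡⟨ θ-cong ψ-split m ⟩
  θ (P n ⊕ y ⊛ R) m                      ≡⟨ θ-⊕ (P n) (y ⊛ R) m ⟩
  θ (P n) m ℤ.+ + m ℤ.* (y ⊛ R) m        ≡⟨ cong₂ (λ a b → a ℤ.+ + m ℤ.* b) (θ-P n m) (q^k-⊛-< R (s≤s m≤2n)) ⟩
  (P n ⊛ L n) m ℤ.+ + m ℤ.* 0ℤ           ≡⟨ cong (ℤ._+_ ((P n ⊛ L n) m)) (ℤₚ.*-zeroʳ (+ m)) ⟩
  -- The zero is reinserted as a coefficient of a multiple of q^(2n+1), so that `L n` can be
  -- factored out.
  (P n ⊛ L n) m ℤ.+ 0ℤ                   ≡⟨ cong (ℤ._+_ ((P n ⊛ L n) m)) (q^k-⊛-< (R ⊛ L n) (s≤s m≤2n)) ⟨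
  (P n ⊛ L n ⊕ y ⊛ (R ⊛ L n)) m          ≡⟨ solve 4 (λ p y r l → p :* l :+ y :* (r :* l) := (p :+ y :* r) :* l)
                                              (λ _ → refl) (P n) y R (L n) m ⟩
  ((P n ⊕ y ⊛ R) ⊛ L n) m                ≡⟨ ⊛-cong ψ-split (λ _ → refl) m ⟨
  (ψ (suc (2 * n)) ⊛ L n) m              ∎
  where
  open ≡-Reasoning
  open SeriesSolver
  y = q^ suc (2 * n)
  R = P n ⊛ H n n
  ψ-split : ψ (suc (2 * n)) ≈ P n ⊕ y ⊛ R
  ψ-split = ≈-trans (≈-sym (shanks n)) (≈-trans (⊛-cong ≈-refl (V-head n n))
    (solve 3 (λ p y h → p :* (con 1ℤ :+ y :* h) := p :+ y :* (p :* h)) (λ _ → refl) (P n) y (H n n)))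

-- Comparison of coefficients

∑-cong : ∀ n {f g : ℕ → ℤ} → (∀ i → f i ≡ g i) → ∑ n f ≡ ∑ n g
∑-cong zero    f≗g = refl
∑-cong (suc n) f≗g = cong₂ ℤ._+_ (∑-cong n f≗g) (f≗g n)

∑-zero : ∀ n {f : ℕ → ℤ} → (∀ {i} → i < n → f i ≡ 0ℤ) → ∑ n f ≡ 0ℤ
∑-zero zero    f≡0 = refl
∑-zero (suc n) f≡0 = cong₂ ℤ._+_ (∑-zero n (f≡0 ∘ m<n⇒m<1+n)) (f≡0 (n<1+n n))

∑-truncate : ∀ {m n} {f : ℕ → ℤ} → m ≤′ n → (∀ {i} → m ≤ i → f i ≡ 0ℤ) → ∑ n f ≡ ∑ m f
∑-truncate         ≤′-refl       f≡0 = refl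
∑-truncate {f = f} (≤′-step m≤n) f≡0 =
  trans (cong₂ ℤ._+_ (∑-truncate {f = f} m≤n f≡0) (f≡0 (≤′⇒≤ m≤n))) (ℤₚ.+-identityʳ _)

∑-single : ∀ {n} i {f : ℕ → ℤ} → i < n → (∀ {j} → j ≢ i → f j ≡ 0ℤ) → ∑ n f ≡ f i
∑-single {n} i {f} i<n f≡0 = begin
  ∑ n f          ≡⟨ ∑-truncate (≤⇒≤′ i<n) (λ i<j → f≡0 (≢-sym (<⇒≢ i<j))) ⟩
  ∑ i f ℤ.+ f i  ≡⟨ cong (λ x → x ℤ.+ f i) (∑-zero i (λ j<i → f≡0 (<⇒≢ j<i))) ⟩
  0ℤ ℤ.+ f i     ≡⟨ ℤₚ.+-identityˡ (f i) ⟩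
  f i            ∎
  where open ≡-Reasoning

-- `∑` grows at its upper end, whereas `applyUpTo` and `sumℤ` work from the front; this reconciles
-- the two.
∑-suc : ∀ n (f : ℕ → ℤ) → ∑ (suc n) f ≡ f 0 ℤ.+ ∑ n (f ∘ suc)
∑-suc zero    f = ℤₚ.+-comm 0ℤ (f 0)
∑-suc (suc n) f = trans (cong (λ x → x ℤ.+ f (suc n)) (∑-suc n f)) (ℤₚ.+-assoc (f 0) _ (f (suc n)))

sumℤ-applyUpTo : ∀ (g : ℕ → ℤ) f n → sumℤ (map g (applyUpTo f n)) ≡ ∑ n (g ∘ f)
sumℤ-applyUpTo g f zero    = refl
sumℤ-applyUpTo g f (suc n) =
  trans (cong (ℤ._+_ (g (f 0))) (sumℤ-applyUpTo g (f ∘ suc) n)) (sym (∑-suc n (g ∘ f)))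

sumℤ-filter : ∀ {ℓ} {P : ℕ → Set ℓ} (P? : Decidable P) (g : ℕ → ℤ) xs →
  sumℤ (map g (filter P? xs)) ≡ sumℤ (map (λ x → if does (P? x) then g x else 0ℤ) xs)
sumℤ-filter P? g []       = refl
sumℤ-filter P? g (x ∷ xs) with does (P? x)
... | true  = cong (ℤ._+_ (g x)) (sumℤ-filter P? g xs)
... | false = trans (sumℤ-filter P? g xs) (sym (ℤₚ.+-identityˡ _))

∑ˢ-⊛ : ∀ n f h m → (∑ˢ n f ⊛ h) m ≡ ∑ n (λ i → (f i ⊛ h) m)
∑ˢ-⊛ zero    f h m = constant-⊛ 0ℤ h m
∑ˢ-⊛ (suc n) f h m =
  trans (⊛-distribʳ-⊕ h (∑ˢ n f) (f n) m) (cong (λ x → x ℤ.+ (f n ⊛ h) m) (∑ˢ-⊛ n f h m))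

-- Triangular numbers and the coefficients of the theta series

T-suc : ∀ m → T (suc m) ≡ T m ℕ.+ suc m
T-suc m = begin
  suc m * (suc m ℕ.+ 1) ℕ./ 2            ≡⟨ cong (ℕ._/ 2) (solve 1 (λ m →
    (con 1 :+ m) :* (con 1 :+ m :+ con 1) := m :* (m :+ con 1) :+ (con 1 :+ m) :* con 2) refl m) ⟩
  (m * (m ℕ.+ 1) ℕ.+ suc m * 2) ℕ./ 2    ≡⟨ +-distrib-/-∣ʳ (m * (m ℕ.+ 1)) (n∣m*n (suc m)) ⟩
  T m ℕ.+ suc m * 2 ℕ./ 2                ≡⟨ cong (T m ℕ.+_) (m*n/n≡m (suc m) 2) ⟩
  T m ℕ.+ suc m                          ∎
  where
  open ≡-Reasoning
  open ℕSolver.+-*-Solver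

T-mono-< : ∀ {m n} → m < n → T m < T n
T-mono-< {m} {n} m<n = begin-strict
  T m            <⟨ m<m+n (T m) (s≤s z≤n) ⟩
  T m ℕ.+ suc m  ≡⟨ T-suc m ⟨
  T (suc m)      ≤⟨ /-monoˡ-≤ 2 (*-mono-≤ m<n (+-monoˡ-≤ 1 m<n)) ⟩
  T n            ∎
  where open ≤-Reasoning

T-injective : ∀ {m n} → T m ≡ T n → m ≡ n
T-injective {m} {n} Tm≡Tn with <-cmp m n
... | tri< m<n _ _ = contradiction Tm≡Tn (<⇒≢ (T-mono-< m<n))
... | tri≈ _ m≡n _ = m≡n
... | tri> _ _ n<m = contradiction (sym Tm≡Tn) (<⇒≢ (T-mono-< n<m))

-- Since `T` is injective, at most one monomial hits the exponent `n`. If `n` is `T m`, then `m` ≤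
-- `T m` = `n` < `N` puts that monomial inside the truncated sum.
ψ-coefficient : ∀ {N n} → n < N → ψ N n ≡ + t n
ψ-coefficient {N} {n} n<N = trans (∑ˢ-coefficient N (λ j → q^ T j) n) (count (triangular? n))
  where
  count : Dec (Triangular n) → ∑ N (λ j → (q^ T j) n) ≡ + t n
  count (yes (m , n≡Tm)) = begin
    ∑ N (λ j → (q^ T j) n)  ≡⟨ ∑-single m (≤-<-trans (subst (m ≤_) (sym n≡Tm) (m≤T[m] m)) n<N)
                                 (λ j≢m → q^k-offDiagonal (λ Tj≡n → j≢m (T-injective (trans Tj≡n n≡Tm)))) ⟩
    (q^ T m) n              ≡⟨ cong (q^ T m) n≡Tm ⟩
    (q^ T m) (T m)          ≡⟨ q^k-diagonal (T m) ⟩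
    1ℤ                      ≡⟨ cong (λ b → + (if b then 1 else 0)) (dec-true (triangular? n) (m , n≡Tm)) ⟨
    + t n                   ∎
    where open ≡-Reasoning
  count (no ¬triangular) = trans
    (∑-zero N (λ {j} _ → q^k-offDiagonal (λ Tj≡n → ¬triangular (j , sym Tj≡n))))
    (cong (λ b → + (if b then 1 else 0)) (sym (dec-false (triangular? n) ¬triangular)))

-- Divisor sums as coefficients of the logarithmic derivative

signedDivisor : ℕ → ℕ → ℤ
signedDivisor m d = if does (d ∣? m) then (if does (2 ∣? d) then ℤ.- + d else + d) else 0ℤ

signedDivisor-sum : ∀ m xs →
  + sum (filter (λ d → ¬? (2 ∣? d)) (filter (_∣? m) xs)) - + sum (filter (2 ∣?_) (filter (_∣? m) xs))
    ≡ sumℤ (map (signedDivisor m) xs)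
signedDivisor-sum m []       = refl
signedDivisor-sum m (x ∷ xs) = step (signedDivisor-sum m xs)
  where
  odds  = sum (filter (λ d → ¬? (2 ∣? d)) (filter (_∣? m) xs))
  evens = sum (filter (2 ∣?_) (filter (_∣? m) xs))
  step : + odds - + evens ≡ sumℤ (map (signedDivisor m) xs) →
    + sum (filter (λ d → ¬? (2 ∣? d)) (filter (_∣? m) (x ∷ xs)))
      - + sum (filter (2 ∣?_) (filter (_∣? m) (x ∷ xs)))
    ≡ sumℤ (map (signedDivisor m) (x ∷ xs))
  step ih with does (x ∣? m)
  ... | false = trans ih (sym (ℤₚ.+-identityˡ _))
  ... | true with does (2 ∣? x)
  ...   | true  = trans
    (solve 3 (λ a b c → a :- (b :+ c) := :- b :+ (a :- c)) refl (+ odds) (+ x) (+ evens))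
    (cong (ℤ._+_ (ℤ.- + x)) ih)
    where open ℤSolver.+-*-Solver
  ...   | false = trans
    (ℤₚ.+-assoc (+ x) (+ odds) (ℤ.- + evens))
    (cong (ℤ._+_ (+ x)) ih)

σᵒ-σᴱ : ∀ m → + σᵒ m - + σᴱ m ≡ ∑ m (λ i → signedDivisor m (suc i))
σᵒ-σᴱ m = trans (signedDivisor-sum m (applyUpTo suc m)) (sumℤ-applyUpTo (signedDivisor m) suc m)

lambert-zero : ∀ d → lambert d 0 ≡ 0ℤ
lambert-zero d = trans (cong (λ b → + d ℤ.* ((if b then 1ℤ else 0ℤ) - 1ℤ)) (dec-true (d ∣? 0) (d ∣0)))
  (ℤₚ.*-zeroʳ (+ d))

-- This removes the boundary index with `T k` = `n` from the convolution, leaving only those with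
-- `T k` < `n`.
L-zero : ∀ n → L n 0 ≡ 0ℤ
L-zero zero    = refl
L-zero (suc n) = cong₂ ℤ._+_ (L-zero n) (cong₂ _-_ (lambert-zero (suc (2 * n))) (lambert-zero (2 * suc n)))

lambert-suc : ∀ d m → lambert d (suc m) ≡ (if does (d ∣? suc m) then + d else 0ℤ)
lambert-suc d m = trans (constant-⊛ (+ d) (geometric d ⊕ ⊝ one) (suc m)) lemma
  where
  lemma : + d ℤ.* (geometric d (suc m) ℤ.+ 0ℤ) ≡ (if does (d ∣? suc m) then + d else 0ℤ)
  lemma with does (d ∣? suc m)
  ... | true  = ℤₚ.*-identityʳ (+ d)
  ... | false = ℤₚ.*-zeroʳ (+ d)

lambert-odd : ∀ {d} m → 2 ∤ d → lambert d (suc m) ≡ signedDivisor (suc m) d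
lambert-odd {d} m 2∤d = trans (lambert-suc d m)
  (cong (λ b → if does (d ∣? suc m) then (if b then ℤ.- + d else + d) else 0ℤ) (sym (dec-false (2 ∣? d) 2∤d)))

lambert-even : ∀ {d} m → 2 ∣ d → ℤ.- lambert d (suc m) ≡ signedDivisor (suc m) d
lambert-even {d} m 2∣d = trans (cong ℤ.-_ (lambert-suc d m)) (trans
  (if-float ℤ.-_ (does (d ∣? suc m)))
  (cong (λ b → if does (d ∣? suc m) then (if b then ℤ.- + d else + d) else 0ℤ) (sym (dec-true (2 ∣? d) 2∣d))))

2∤1+2n : ∀ n → 2 ∤ suc (2 * n)
2∤1+2n n 2∣1+2n = contradiction (∣1⇒≡1 (∣m+n∣m⇒∣n (subst (2 ∣_) (+-comm 1 (2 * n)) 2∣1+2n) (m∣m*n n))) λ ()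

-- The step from `n` to `suc n` brings in exactly the candidate divisors 2n+1 and 2n+2, one odd and
-- one even, with the matching signs. The first `n` steps thus account for 1, ..., 2n.
L-suc : ∀ n m → L n (suc m) ≡ ∑ (2 * n) (λ i → signedDivisor (suc m) (suc i))
L-suc zero    m = refl
L-suc (suc n) m = begin
  L n (suc m) ℤ.+ (lambert (suc (2 * n)) (suc m) - lambert (2 * suc n) (suc m))
    ≡⟨ cong₂ ℤ._+_ (L-suc n m) (cong₂ ℤ._+_ (lambert-odd m (2∤1+2n n)) (lambert-even m (m∣m*n (suc n)))) ⟩
  ∑ (2 * n) s ℤ.+ (s (2 * n) ℤ.+ signedDivisor (suc m) (2 * suc n))
    ≡⟨ cong (λ k → ∑ (2 * n) s ℤ.+ (s (2 * n) ℤ.+ signedDivisor (suc m) k)) (*-suc 2 n) ⟩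
  ∑ (2 * n) s ℤ.+ (s (2 * n) ℤ.+ s (suc (2 * n)))
    ≡⟨ ℤₚ.+-assoc (∑ (2 * n) s) (s (2 * n)) (s (suc (2 * n))) ⟨
  ∑ (2 ℕ.+ 2 * n) s
    ≡⟨ cong (λ k → ∑ k s) (*-suc 2 n) ⟨
  ∑ (2 * suc n) s ∎
  where
  open ≡-Reasoning
  s = λ i → signedDivisor (suc m) (suc i)

-- For `m` ≤ 2n the candidates 1, ..., 2n include all divisors of `m`, and those beyond `m`
-- contribute zero.
L-coefficient : ∀ n {m} .{{_ : NonZero m}} → m ≤ 2 * n → L n m ≡ + σᵒ m - + σᴱ m
L-coefficient n {suc m} m≤2n = begin
  L n (suc m)       ≡⟨ L-suc n m ⟩
  ∑ (2 * n) s       ≡⟨ ∑-truncate (≤⇒≤′ m≤2n) (λ {i} 1+m≤i →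
                         cong (λ b → if b then (if does (2 ∣? suc i) then ℤ.- + suc i else + suc i) else 0ℤ)
                           (dec-false (suc i ∣? suc m) (>⇒∤ (s≤s 1+m≤i)))) ⟩
  ∑ (suc m) s       ≡⟨ σᵒ-σᴱ (suc m) ⟨
  + σᵒ (suc m) - + σᴱ (suc m) ∎
  where
  open ≡-Reasoning
  s = λ i → signedDivisor (suc m) (suc i)

theorem3p6 : ∀ (n : ℕ) .{{_ : NonZero n}} →
    + (t n * n) ≡ sumℤ (map (λ k → + σᵒ (n ∸ T k) - + σᴱ (n ∸ T k)) (indices n))
theorem3p6 n = begin
  + (t n * n)                              ≡⟨ cong +_ (*-comm (t n) n) ⟩
  + (n * t n)                              ≡⟨ ℤₚ.pos-* n (t n) ⟩
  -- The truncation level is `n` itself: only coefficients up to index `n` ≤ 2n occur.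
  + n ℤ.* + t n                            ≡⟨ cong (ℤ._*_ (+ n)) (ψ-coefficient (s≤s n≤2n)) ⟨
  θ (ψ (suc (2 * n))) n                    ≡⟨ ψ-logarithmicDerivative {n} n≤2n ⟩
  (ψ (suc (2 * n)) ⊛ L n) n                ≡⟨ ∑ˢ-⊛ (suc (2 * n)) (λ j → q^ T j) (L n) n ⟩
  ∑ (suc (2 * n)) (λ j → (q^ T j ⊛ L n) n) ≡⟨ ∑-cong (suc (2 * n)) term-coefficient ⟩
  -- Indices `k` ≥ `n` drop out because `T k` ≥ `k`, which matches the search range of `indices n`.
  ∑ (suc (2 * n)) term                     ≡⟨ ∑-truncate (≤⇒≤′ (m≤n⇒m≤1+n n≤2n)) term-vanishes ⟩
  ∑ n term                                 ≡⟨ sumℤ-applyUpTo term id n ⟨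
  sumℤ (map term (upTo n))                 ≡⟨ sumℤ-filter (λ k → T k <? n) summand (upTo n) ⟨
  sumℤ (map summand (indices n))           ∎
  where
  open ≡-Reasoning
  n≤2n : n ≤ 2 * n
  n≤2n = m≤m+n n (1 * n)
  summand term : ℕ → ℤ
  summand k = + σᵒ (n ∸ T k) - + σᴱ (n ∸ T k)
  term k = if does (T k <? n) then summand k else 0ℤ
  term-vanishes : ∀ {k} → n ≤ k → term k ≡ 0ℤ
  term-vanishes {k} n≤k =
    cong (λ b → if b then summand k else 0ℤ) (dec-false (T k <? n) (≤⇒≯ (≤-trans n≤k (m≤T[m] k))))
  term-coefficient : ∀ k → (q^ T k ⊛ L n) n ≡ term k
  term-coefficient k with <-cmp (T k) n
  ... | tri< Tk<n _ _ = begin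
    (q^ T k ⊛ L n) n  ≡⟨ q^k-⊛-≥ (L n) (<⇒≤ Tk<n) ⟩
    L n (n ∸ T k)     ≡⟨ L-coefficient n {{ℕ.>-nonZero (m<n⇒0<n∸m Tk<n)}} (≤-trans (m∸n≤m n (T k)) n≤2n) ⟩
    summand k         ≡⟨ cong (λ b → if b then summand k else 0ℤ) (dec-true (T k <? n) Tk<n) ⟨
    term k            ∎
  -- Here the monomial meets the constant coefficient of `L n`, which is zero.
  ... | tri≈ Tk≮n Tk≡n _ = begin
    (q^ T k ⊛ L n) n  ≡⟨ q^k-⊛-≥ (L n) (≤-reflexive Tk≡n) ⟩
    L n (n ∸ T k)     ≡⟨ cong (L n) (m≤n⇒m∸n≡0 (≤-reflexive (sym Tk≡n))) ⟩
    L n 0             ≡⟨ L-zero n ⟩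
    0ℤ                ≡⟨ cong (λ b → if b then summand k else 0ℤ) (dec-false (T k <? n) Tk≮n) ⟨
    term k            ∎
  ... | tri> Tk≮n _ n<Tk = begin
    (q^ T k ⊛ L n) n  ≡⟨ q^k-⊛-< (L n) n<Tk ⟩
    0ℤ                ≡⟨ cong (λ b → if b then summand k else 0ℤ) (dec-false (T k <? n) Tk≮n) ⟨
    term k            ∎
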